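{- For all barriers $B$, $\mathsf{TS}^B\leq_{\mathrm{sW}}\mathsf{RT}^B_2$.
   Context: $\mathbb{N}$ is the set of natural numbers (including $0$). Subsets of $\mathbb{N}$ are identified with their strictly increasing enumerations; $s\sqsubset Y$ means that $s$ is a proper initial segment of $Y$ as a sequence; $\subset$ is strict set inclusion. A set $B$ of finite subsets of $\mathbb{N}$ is a barrier on an infinite set $X\subseteq\mathbb{N}$ if: (1) $\bigcup B=X$; (2) for all $s,t\in B$, $s\not\subset t$; (3) for every infinite $Y\subseteq X$ there is $s\in B$ with $s\sqsubset Y$. The set $X=\bigcup B$ is the base of $B$. For infinite $Y\subseteq X$, $B\vert Y=\{s\in B: s\subseteq Y\}$ (this is a barrier on $Y$, and every barrier $B'\subseteq B$ has this form). $\mathsf{TS}^B$ is the problem whose instances are the functions $f:B\to\mathbb{N}$, where a solution to $f$ is an infinite $Y$ contained in the base of $B$ such that $f(B\vert Y)\neq\mathbb{N}$. For a positive integer $k$, $\mathsf{RT}^B_k$ is the problem whose instances are the functions $g:B\to k=\{0,\dots,k-1\}$, where a solution to $g$ is an infinite subset $H$ of the base of $B$ such that $g$ is constant on $B\vert H$. Instances and solutions are coded as subsets of $\mathbb{N}$ in a standard way, a coloring being given together with its domain (so that the barrier is uniformly computable from a coloring of it). For such problems $\mathsf{P},\mathsf{Q}$, $\mathsf{Q}\leq_{\mathrm{sW}}\mathsf{P}$ (strong Weihrauch reducibility) means: there are Turing functionals $\Phi,\Psi$ such that for every instance $I$ of $\mathsf{Q}$, $\Phi(I)$ is an instance of $\mathsf{P}$,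 and for every solution $\hat Y$ to $\Phi(I)$, $\Psi(\hat Y)$ is a solution to $I$ for $\mathsf{Q}$. -}

module Defs where

open import Data.Bool.Base using (Bool; true; false; T)
open import Data.Fin.Base using (Fin; toℕ)
open import Data.List.Base using (List; map; sum; applyUpTo)
import Data.List.Membership.Propositional as List
open import Data.List.Relation.Unary.Linked using (Linked)
open import Data.Nat.Base using (ℕ; zero; suc; _+_; _*_; _^_; _<_; NonZero)
open import Data.Product.Base using (Σ; ∃; ∃-syntax; _×_; _,_; proj₁)
open import Data.Vec.Base using (Vec; []; _∷_; lookup)
open import Data.Vec.Relation.Binary.Pointwise.Inductive using (Pointwise)
open import Function.Base using (_∘_)
open import Function.Bundles using (_⇔_)
open import Level using (0ℓ)
open import Relation.Binary.PropositionalEquality.Core using (_≡_)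
open import Relation.Nullary.Negation.Core using (¬_)
open import Relation.Unary using (Pred; _∈_; _⊆_; _⊂_; _≐_; U)

-- Sets are given by characteristic functions, so that a set of natural
-- numbers is a possible oracle and a possible output of a computation.

℘ : Set → Set
℘ A = A → Bool

⟦_⟧ : {A : Set} → ℘ A → Pred A 0ℓ
⟦ Y ⟧ = T ∘ Y

Infinite : ℘ ℕ → Set
Infinite Y = ∀ n → ∃[ m ] n < m × m ∈ ⟦ Y ⟧

record FinSet : Set where
  constructor finSet
  field
    list        : List ℕ
    .increasing : Linked _<_ list

  elements : Pred ℕ 0ℓ
  elements n = n List.∈ list

open FinSet public using (list; elements)

record Enumerates (e : ℕ → ℕ) (Y : ℘ ℕ) : Set where
  field
    increasing : ∀ {i j} → i < j → e i < e j
    range      : ∀ n → n ∈ ⟦ Y ⟧ ⇔ (∃[ i ] e i ≡ n)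

-- Used for infinite Y only, where a finite initial segment is
-- automatically a proper one.

infix 4 _⊏_

_⊏_ : FinSet → ℘ ℕ → Set
s ⊏ Y = ∃[ e ] Enumerates e Y × ∃[ k ] list s ≡ applyUpTo e k

Image : {A C : Set} → (A → C) → Pred A 0ℓ → Pred C 0ℓ
Image f P c = ∃[ a ] a ∈ P × f a ≡ c

record IsBarrierOn (B : ℘ FinSet) (X : ℘ ℕ) : Set where
  field
    infinite  : Infinite X
    union     : ∀ n → n ∈ ⟦ X ⟧ ⇔ (∃[ s ] s ∈ ⟦ B ⟧ × n ∈ elements s)
    antichain : ∀ s t → s ∈ ⟦ B ⟧ → t ∈ ⟦ B ⟧ → ¬ (elements s ⊂ elements t)
    segment   : ∀ Y → Infinite Y → ⟦ Y ⟧ ⊆ ⟦ X ⟧ → ∃[ s ] s ∈ ⟦ B ⟧ × s ⊏ Y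

record Barrier : Set where
  field
    members     : ℘ FinSet
    base        : ℘ ℕ
    isBarrierOn : IsBarrierOn members base

  Member : Set
  Member = Σ FinSet (_∈ ⟦ members ⟧)

open Barrier public using (members; base; Member)

infix 6 _∣_

_∣_ : (B : Barrier) → ℘ ℕ → Pred (Member B) 0ℓ
(B ∣ Y) s = elements (proj₁ s) ⊆ ⟦ Y ⟧

-- The canonical index of a finite set.

index : FinSet → ℕ
index s = sum (map (2 ^_) (list s))

triangle : ℕ → ℕ
triangle zero    = zero
triangle (suc n) = suc n + triangle n

-- The Cantor pairing function.

pair : ℕ → ℕ → ℕ
pair m n = triangle (m + n) + n

-- I is the join of the domain and the graph of c.  Since index and pair
-- are bijections onto ℕ, every coloring has exactly one code, up to
-- pointwise equality.

Codes : (B : Barrier) → ℘ ℕ → (Member B → ℕ) → Set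
Codes B I c =
    (∀ s → 2 * index s ∈ ⟦ I ⟧ ⇔ s ∈ ⟦ members B ⟧)
  × (∀ s n → suc (2 * pair (index s) n) ∈ ⟦ I ⟧ ⇔ (∃[ p ] c (s , p) ≡ n))

record Problem : Set₁ where
  field
    Instance   : Set
    IsCodeOf   : ℘ ℕ → Instance → Set
    IsSolution : ℘ ℕ → Instance → Set

TS : Barrier → Problem
TS B = record
  { Instance   = Member B → ℕ
  ; IsCodeOf   = Codes B
  ; IsSolution = λ Y f →
      Infinite Y × ⟦ Y ⟧ ⊆ ⟦ base B ⟧ × ¬ (Image f (B ∣ Y) ≐ U)
  }

RT : (k : ℕ) → .{{NonZero k}} → Barrier → Problem
RT k B = record
  { Instance   = Member B → Fin k
  ; IsCodeOf   = λ I g → Codes B I (toℕ ∘ g)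
  ; IsSolution = λ H g →
      Infinite H × ⟦ H ⟧ ⊆ ⟦ base B ⟧ ×
      (∀ s t → s ∈ B ∣ H → t ∈ B ∣ H → g s ≡ g t)
  }

-- Programs for the n-ary functions that are partial recursive relative to
-- an oracle.

data Program : ℕ → Set where
  zero    : Program 0
  succ    : Program 1
  query   : Program 1
  proj    : ∀ {n} → Fin n → Program n
  compose : ∀ {m n} → Program m → Vec (Program n) m → Program n
  primrec : ∀ {n} → Program n → Program (2 + n) → Program (1 + n)
  minimum : ∀ {n} → Program (1 + n) → Program n

bit : Bool → ℕ
bit false = 0
bit true  = 1

data Eval (A : ℘ ℕ) : ∀ {n} → Program n → Vec ℕ n → ℕ → Set where
  zero    : Eval A zero [] 0
  succ    : ∀ {x} → Eval A succ (x ∷ []) (suc x)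
  query   : ∀ {x} → Eval A query (x ∷ []) (bit (A x))
  proj    : ∀ {n} {xs : Vec ℕ n} (i : Fin n) →
            Eval A (proj i) xs (lookup xs i)
  compose : ∀ {m n P} {Qs : Vec (Program n) m} {xs ys z} →
            Pointwise (λ Q y → Eval A Q xs y) Qs ys →
            Eval A P ys z → Eval A (compose P Qs) xs z
  primrec-zero : ∀ {n} {P : Program n} {Q xs y} →
            Eval A P xs y → Eval A (primrec P Q) (0 ∷ xs) y
  primrec-suc  : ∀ {n} {P : Program n} {Q xs i y z} →
            Eval A (primrec P Q) (i ∷ xs) y → Eval A Q (i ∷ y ∷ xs) z →
            Eval A (primrec P Q) (suc i ∷ xs) z
  minimum : ∀ {n} {P : Program (1 + n)} {xs y} →
            (∀ z → z < y → ∃[ w ] Eval A P (z ∷ xs) (suc w)) →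
            Eval A P (y ∷ xs) 0 → Eval A (minimum P) xs y

TuringFunctional : Set
TuringFunctional = Program 1

infix 4 _[_]↓_

_[_]↓_ : TuringFunctional → ℘ ℕ → ℘ ℕ → Set
Φ [ A ]↓ Z = ∀ n → Eval A Φ (n ∷ []) (bit (Z n))

-- Problem instances are reached through their codes; solutions are sets of
-- natural numbers already and serve as their own codes.

infix 4 _≤sW_

_≤sW_ : Problem → Problem → Set
Q ≤sW P = ∃[ Φ ] ∃[ Ψ ]
  (∀ I i → Q.IsCodeOf I i →
    ∃[ Î ] Φ [ I ]↓ Î × ∃[ î ] P.IsCodeOf Î î ×
      (∀ Ŷ → P.IsSolution Ŷ î → ∃[ Y ] Ψ [ Ŷ ]↓ Y × Q.IsSolution Y i))
  where
  module Q = Problem Q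
  module P = Problem P

{-# OPTIONS --safe #-}

-- Collapse all nonzero colors of f to 1.  A homogeneous set for the resulting
-- 2-coloring cannot see both of the colors 0 and 1 of f, so it already solves
-- f, and Ψ is the identity.  The new code is computable from the old one: a
-- set s gets color 0 iff it had it, and color 1 iff s ∈ B but s lacks color 0.

module Submission where

open import Data.Nat.Base using (nonZero)
open import Defs
open import Data.Bool.Base using (Bool; true; false; T; not; _∧_)
open import Data.Bool.Properties using (T-irrelevant; T-∧)
open import Data.Fin.Base using (Fin; toℕ)
open import Data.Fin.Patterns using (0F; 1F; 2F; 3F)
open import Data.Fin.Properties using (toℕ<n)
open import Data.Nat.Base using (ℕ; zero; suc; pred; _+_; _*_; _∸_; _≤_; _<_; z≤n; s≤s; s≤s⁻¹)
open import Data.Nat.Properties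
open import Data.Product.Base using (Σ; ∃-syntax; _×_; _,_; proj₁; proj₂)
open import Data.Sum.Base using (inj₁; inj₂)
open import Data.Unit.Base using (tt)
open import Data.Vec.Base using (Vec; []; _∷_; lookup; map)
open import Data.Vec.Relation.Binary.Pointwise.Inductive using (Pointwise; []; _∷_)
open import Data.Vec.Relation.Unary.All using (All; []; _∷_)
open import Function.Base using (_∘_)
open import Function.Bundles using (_⇔_; mk⇔; Equivalence)
open import Relation.Binary.PropositionalEquality using (_≡_; refl; sym; trans; cong; subst)
open import Relation.Nullary.Negation.Core using (¬_; contradiction)
open import Relation.Unary using (_∈_; _≐_; U)

-- Total functionals computable from an oracle.

cases : {C : Set} → ℕ → C → C → C
cases zero    a b = a
cases (suc _) a b = b

cases-map : {C D : Set} (h : C → D) → ∀ k {a b} → h (cases k a b) ≡ cases k (h a) (h b)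
cases-map h zero    = refl
cases-map h (suc _) = refl

Functional : ℕ → Set
Functional n = ℘ ℕ → Vec ℕ n → ℕ

-- The program is chosen before the oracle, so a single one serves as the Turing functional for all
-- instances.
Computable : ∀ {n} → Functional n → Set
Computable {n} F = Σ (Program n) λ P → ∀ A xs → Eval A P xs (F A xs)

private
  variable
    m n : ℕ
    F G H : Functional n

resp : (∀ A xs → F A xs ≡ G A xs) → Computable F → Computable G
resp F≡G (P , eval) = P , λ A xs → subst (Eval A P xs) (F≡G A xs) (eval A xs)

private
  programs : {Gs : Vec (Functional n) m} → All Computable Gs →
             Σ (Vec (Program n) m) λ Qs →
               ∀ A xs → Pointwise (λ Q y → Eval A Q xs y) Qs (map (λ G → G A xs) Gs)
  programs []               = [] , λ A xs → []
  programs ((Q , eval) ∷ c) = Q ∷ proj₁ (programs c) , λ A xs → eval A xs ∷ proj₂ (programs c) A xs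

apply : {Gs : Vec (Functional n) m} → Computable F → All Computable Gs →
        Computable (λ A xs → F A (map (λ G → G A xs) Gs))
apply (P , eval) c =
  compose P (proj₁ (programs c)) , λ A xs → compose (proj₂ (programs c) A xs) (eval A _)

-- `F` is given in advance and only has to obey the recursion equations, so a function defined by
-- pattern matching qualifies as it stands, mostly by `refl`.
recursion : (F : Functional (suc n)) → Computable G → Computable H →
            (∀ A xs → F A (0 ∷ xs) ≡ G A xs) →
            (∀ A i xs → F A (suc i ∷ xs) ≡ H A (i ∷ F A (i ∷ xs) ∷ xs)) →
            Computable F
recursion F (P , evalP) (Q , evalQ) F-zero F-suc = primrec P Q , eval
  where
  eval : ∀ A xs → Eval A (primrec P Q) xs (F A xs)
  eval A (zero  ∷ xs) = subst (Eval A _ _) (sym (F-zero A xs)) (primrec-zero (evalP A xs))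
  eval A (suc i ∷ xs) =
    subst (Eval A _ _) (sym (F-suc A i xs)) (primrec-suc (eval A (i ∷ xs)) (evalQ A _))

var : (i : Fin n) → Computable (λ _ xs → lookup xs i)
var i = proj i , λ _ _ → proj i

zeroᶜ : Computable {n} (λ _ _ → 0)
zeroᶜ = compose zero [] , λ _ _ → compose [] zero

sucᶜ : Computable F → Computable (λ A xs → suc (F A xs))
sucᶜ f = apply {F = λ _ xs → suc (lookup xs 0F)} (succ , λ { _ (x ∷ []) → succ }) (f ∷ [])

queryᶜ : Computable F → Computable (λ A xs → bit (A (F A xs)))
queryᶜ f = apply {F = λ A xs → bit (A (lookup xs 0F))} (query , λ { _ (x ∷ []) → query }) (f ∷ [])

infixl 6 _+ᶜ_ _∸ᶜ_

_+ᶜ_ : Computable F → Computable G → Computable (λ A xs → F A xs + G A xs)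
f +ᶜ g = apply add (f ∷ g ∷ [])
  where
  add : Computable {2} (λ _ xs → lookup xs 0F + lookup xs 1F)
  add = recursion _ (var 0F) (sucᶜ (var 1F)) (λ _ _ → refl) (λ _ _ _ → refl)

predᶜ : Computable F → Computable (λ A xs → pred (F A xs))
predᶜ f = apply predecessor (f ∷ [])
  where
  predecessor : Computable {1} (λ _ xs → pred (lookup xs 0F))
  predecessor = recursion _ zeroᶜ (var 0F) (λ _ _ → refl) (λ _ _ _ → refl)

_∸ᶜ_ : Computable F → Computable G → Computable (λ A xs → F A xs ∸ G A xs)
-- The arguments are swapped: the recursion runs on the first one, which has to be the subtrahend.
f ∸ᶜ g = apply monus (g ∷ f ∷ [])
  where
  monus : Computable {2} (λ _ xs → lookup xs 1F ∸ lookup xs 0F)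
  monus = recursion _ (var 0F) (predᶜ (var 1F)) (λ _ _ → refl)
    (λ _ i xs → sym (pred[m∸n]≡m∸[1+n] (lookup xs 0F) i))

casesᶜ : Computable F → Computable G → Computable H →
         Computable (λ A xs → cases (F A xs) (G A xs) (H A xs))
casesᶜ f g h = apply caseDistinction (f ∷ g ∷ h ∷ [])
  where
  caseDistinction : Computable {3} (λ _ xs → cases (lookup xs 0F) (lookup xs 1F) (lookup xs 2F))
  -- In the successor step the predecessor and the previous value come first, so the second
  -- alternative sits at position 3.
  caseDistinction = recursion _ (var 0F) (var 3F) (λ _ _ → refl) (λ _ _ _ → refl)

doubleᶜ : Computable F → Computable (λ A xs → 2 * F A xs)
-- `2 * x` unfolds to `x + (x + 0)`.
doubleᶜ f = f +ᶜ (f +ᶜ zeroᶜ)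

triangleᶜ : Computable F → Computable (λ A xs → triangle (F A xs))
triangleᶜ f = apply triangular (f ∷ [])
  where
  triangular : Computable {1} (λ _ xs → triangle (lookup xs 0F))
  triangular = recursion _ zeroᶜ (sucᶜ (var 0F) +ᶜ var 1F) (λ _ _ → refl) (λ _ _ _ → refl)

pairᶜ : Computable F → Computable G → Computable (λ A xs → pair (F A xs) (G A xs))
pairᶜ f g = triangleᶜ (f +ᶜ g) +ᶜ g

-- Inverting doubling and the Cantor pairing.

-- For t strictly increasing with t 0 ≡ 0, the greatest r such that t r ≤ x.

floorInverse : (ℕ → ℕ) → ℕ → ℕ
floorInverse t zero    = 0
floorInverse t (suc x) = cases (t (suc r) ∸ suc x) (suc r) r
  where r = floorInverse t x

floorInverseᶜ : ∀ {t} → Computable {1} (λ _ xs → t (lookup xs 0F)) →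
                Computable F → Computable (λ A xs → floorInverse t (F A xs))
floorInverseᶜ {t = t} tᶜ f = apply inverse (f ∷ [])
  where
  inverse : Computable {1} (λ _ xs → floorInverse t (lookup xs 0F))
  inverse = recursion _ zeroᶜ
    (casesᶜ (apply tᶜ (sucᶜ (var 1F) ∷ []) ∸ᶜ sucᶜ (var 0F)) (sucᶜ (var 1F)) (var 1F))
    (λ _ _ → refl) (λ _ _ _ → refl)

module _ (t : ℕ → ℕ) (t-zero : t 0 ≡ 0) (t-suc : ∀ i → t i < t (suc i)) where

  private
    t-mono : ∀ {i j} → i ≤ j → t i ≤ t j
    t-mono {j = zero}  z≤n = ≤-refl
    t-mono {j = suc j} i≤1+j with m≤n⇒m<n∨m≡n i≤1+j
    ... | inj₁ i<1+j = ≤-trans (t-mono (s≤s⁻¹ i<1+j)) (<⇒≤ (t-suc j))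
    ... | inj₂ refl  = ≤-refl

    t-cancel-< : ∀ {i j} → t i < t j → i < j
    t-cancel-< ti<tj = ≰⇒> λ j≤i → <⇒≱ ti<tj (t-mono j≤i)

  floorInverse-bounds : ∀ x → t (floorInverse t x) ≤ x × x < t (suc (floorInverse t x))
  floorInverse-bounds zero = ≤-reflexive t-zero , subst (_< t 1) t-zero (t-suc 0)
  floorInverse-bounds (suc x)
    with floorInverse t x | floorInverse-bounds x
  ... | r | tr≤x , x<t[1+r] with t (suc r) ∸ suc x in eq
  -- Raising the root by one is enough: `suc x` is at most `t (suc r)`, hence below
  -- `t (suc (suc r))`.
  ...   | zero  = m∸n≡0⇒m≤n eq , ≤-<-trans x<t[1+r] (t-suc (suc r))
  ...   | suc _ = m≤n⇒m≤1+n tr≤x , m∸n≢0⇒n<m λ eq′ → 0≢1+n (trans (sym eq′) eq)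

  -- Of two roots for the same `x`, each has its `t` value at most `x` and so below the `t` value at
  -- the successor of the other; by monotonicity each is at most the other.
  floorInverse-unique : ∀ {x r} → t r ≤ x → x < t (suc r) → floorInverse t x ≡ r
  floorInverse-unique {x} tr≤x x<t[1+r] =
    let lower , upper = floorInverse-bounds x in
    ≤-antisym (s≤s⁻¹ (t-cancel-< (≤-<-trans lower x<t[1+r])))
              (s≤s⁻¹ (t-cancel-< (≤-<-trans tr≤x upper)))

half : ℕ → ℕ
half = floorInverse (2 *_)

2*-suc : ∀ k → 2 * suc k ≡ suc (suc (2 * k))
2*-suc k = cong suc (+-suc k (k + 0))

half-unique : ∀ {x k} → 2 * k ≤ x → x < suc (suc (2 * k)) → half x ≡ k
half-unique {x} {k} lower upper =
  floorInverse-unique (2 *_) refl (λ i → *-monoʳ-< 2 (n<1+n i)) lower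
    (subst (x <_) (sym (2*-suc k)) upper)

half-even : ∀ k → half (2 * k) ≡ k
half-even k = half-unique ≤-refl (m<n⇒m<1+n (n<1+n _))

half-odd : ∀ k → half (suc (2 * k)) ≡ k
half-odd k = half-unique (n≤1+n _) (n<1+n _)

triangleRoot : ℕ → ℕ
triangleRoot = floorInverse triangle

-- The offset `n` on the diagonal `m + n` is smaller than `suc (m + n)`, the gap to the next
-- triangular number.
triangleRoot-pair : ∀ m n → triangleRoot (pair m n) ≡ m + n
triangleRoot-pair m n =
  floorInverse-unique triangle refl (λ i → s≤s (m≤n+m (triangle i) i)) (m≤m+n _ n)
    (s≤s (subst (_≤ m + n + triangle (m + n)) (+-comm n _)
      (+-monoˡ-≤ (triangle (m + n)) (m≤n+m n m))))

unpair₁ unpair₂ : ℕ → ℕ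
unpair₂ p = p ∸ triangle (triangleRoot p)
unpair₁ p = triangleRoot p ∸ unpair₂ p

unpair₂-pair : ∀ m n → unpair₂ (pair m n) ≡ n
unpair₂-pair m n rewrite triangleRoot-pair m n = m+n∸m≡n (triangle (m + n)) n

unpair₁-pair : ∀ m n → unpair₁ (pair m n) ≡ m
unpair₁-pair m n rewrite unpair₂-pair m n | triangleRoot-pair m n = m+n∸n≡m m n

-- The code of the collapsed coloring, and its computability.

-- The oracle A stands for the code of f, and m for the index of s.

colorBit : ℘ ℕ → ℕ → ℕ → Bool
colorBit A m 0             = A (suc (2 * pair m 0))
colorBit A m 1             = A (2 * m) ∧ not (A (suc (2 * pair m 0)))
colorBit A m (suc (suc _)) = false

-- The test `x ∸ 2 * half x` is the parity of `x`. Even positions describe the domain, which stays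
-- the same; odd ones describe the graph.
collapseCode : ℘ ℕ → ℘ ℕ
collapseCode A x = cases (x ∸ 2 * half x) (A x) (colorBit A (unpair₁ (half x)) (unpair₂ (half x)))

collapseCode-even : ∀ A k → collapseCode A (2 * k) ≡ A (2 * k)
collapseCode-even A k rewrite half-even k | n∸n≡0 (2 * k) = refl

collapseCode-odd : ∀ A m n → collapseCode A (suc (2 * pair m n)) ≡ colorBit A m n
collapseCode-odd A m n
  rewrite half-odd (pair m n) | m+n∸n≡m 1 (2 * pair m n)
        | unpair₁-pair m n | unpair₂-pair m n = refl

bit-∧-not : ∀ a b → bit (a ∧ not b) ≡ bit a ∸ bit b
bit-∧-not false false = refl
bit-∧-not false true  = refl
bit-∧-not true  false = refl
bit-∧-not true  true  = refl

-- An arithmetic form from which a program can be assembled: zero tests of `n` and `pred n` separate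
-- the three clauses, and truncated subtraction of bits expresses "and not".
bit-colorBit : ∀ A m n → let b = bit (A (suc (2 * pair m 0))) in
  cases n b (cases (pred n) (bit (A (2 * m)) ∸ b) 0) ≡ bit (colorBit A m n)
bit-colorBit A m 0             = refl
bit-colorBit A m 1             = sym (bit-∧-not (A (2 * m)) _)
bit-colorBit A m (suc (suc _)) = refl

halfᶜ : Computable F → Computable (λ A xs → half (F A xs))
halfᶜ = floorInverseᶜ (doubleᶜ (var 0F))

triangleRootᶜ : Computable F → Computable (λ A xs → triangleRoot (F A xs))
triangleRootᶜ = floorInverseᶜ (triangleᶜ (var 0F))

unpair₂ᶜ : Computable F → Computable (λ A xs → unpair₂ (F A xs))
unpair₂ᶜ f = f ∸ᶜ triangleᶜ (triangleRootᶜ f)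

unpair₁ᶜ : Computable F → Computable (λ A xs → unpair₁ (F A xs))
unpair₁ᶜ f = triangleRootᶜ f ∸ᶜ unpair₂ᶜ f

colorBitᶜ : Computable F → Computable G → Computable (λ A xs → bit (colorBit A (F A xs) (G A xs)))
colorBitᶜ {F = F} {G = G} f g =
  resp (λ A xs → bit-colorBit A (F A xs) (G A xs))
    (casesᶜ g b (casesᶜ (predᶜ g) (queryᶜ (doubleᶜ f) ∸ᶜ b) zeroᶜ))
  where b = queryᶜ (sucᶜ (doubleᶜ (pairᶜ f zeroᶜ)))

collapseCodeᶜ : Computable {1} (λ A xs → bit (collapseCode A (lookup xs 0F)))
collapseCodeᶜ =
  resp (λ A xs → let x = lookup xs 0F in sym (cases-map bit (x ∸ 2 * half x)))
    (casesᶜ (x ∸ᶜ doubleᶜ p) (queryᶜ x) (colorBitᶜ (unpair₁ᶜ p) (unpair₂ᶜ p)))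
  where
  x = var 0F
  p = halfᶜ x

-- Correctness of the new code and of the reduction.

T-not : ∀ {x} → T (not x) ⇔ (¬ T x)
T-not {false} = mk⇔ (λ _ ()) (λ _ → tt)
T-not {true}  = mk⇔ (λ ()) (λ ¬tt → ¬tt tt)

collapse : ℕ → Fin 2
collapse zero    = 0F
collapse (suc _) = 1F

collapse≡0 : ∀ n → toℕ (collapse n) ≡ 0 → n ≡ 0
collapse≡0 zero _ = refl

collapseCode-codes : ∀ B I (f : Member B → ℕ) → Codes B I f →
                     Codes B (collapseCode I) (toℕ ∘ collapse ∘ f)
collapseCode-codes B I f (domain , graph) = domain′ , graph′
  where
  module D s = Equivalence (domain s)
  module C s n = Equivalence (graph s n)

  domain′ : ∀ s → 2 * index s ∈ ⟦ collapseCode I ⟧ ⇔ s ∈ ⟦ members B ⟧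
  domain′ s rewrite collapseCode-even I (index s) = domain s

  graph′ : ∀ s n → suc (2 * pair (index s) n) ∈ ⟦ collapseCode I ⟧ ⇔
           (∃[ p ] toℕ (collapse (f (s , p))) ≡ n)
  graph′ s n rewrite collapseCode-odd I (index s) n = colors n
    where
    colors : ∀ n → T (colorBit I (index s) n) ⇔ (∃[ p ] toℕ (collapse (f (s , p))) ≡ n)
    colors 0 = mk⇔
      (λ i → let p , fp≡0 = C.to s 0 i in p , cong (toℕ ∘ collapse) fp≡0)
      (λ (p , eq) → C.from s 0 (p , collapse≡0 _ eq))
    colors 1 = mk⇔ to from
      where
      to : T (colorBit I (index s) 1) → ∃[ p ] toℕ (collapse (f (s , p))) ≡ 1
      to i with Equivalence.to T-∧ i
      ... | inDomain , notZero = p , positive (f (s , p)) refl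
        where
        p = D.to s inDomain
        -- The color becomes a variable so that it can be split; if it were zero, the graph of `f`
        -- would record it, against `notZero`.
        positive : ∀ c → f (s , p) ≡ c → toℕ (collapse c) ≡ 1
        positive zero    eq = contradiction (C.from s 0 (p , eq)) (Equivalence.to T-not notZero)
        positive (suc _) _  = refl
      from : (∃[ p ] toℕ (collapse (f (s , p))) ≡ 1) → T (colorBit I (index s) 1)
      from (p , eq) = Equivalence.from T-∧ (D.from s p , Equivalence.from T-not notZero)
        where
        notZero : ¬ T (I (suc (2 * pair (index s) 0)))
        notZero i with C.to s 0 i
        -- The code yields its own membership proof `p′`; irrelevance identifies it with `p`, so the
        -- color at `p` is 0, although it collapses to 1.
        ... | p′ , fp′≡0 rewrite T-irrelevant p p′ | fp′≡0 = 0≢1+n eq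
    colors (suc (suc n)) = mk⇔ (λ ()) λ (p , eq) →
      contradiction (subst (_< 2) eq (toℕ<n (collapse (f (s , p))))) (λ { (s≤s (s≤s ())) })

-- If every color occurred, there would be members of colors 0 and 1, and these collapse to the
-- distinct values `0F` and `1F`.
collapse-homogeneous : ∀ B (f : Member B → ℕ) H →
  (∀ s t → s ∈ B ∣ H → t ∈ B ∣ H → collapse (f s) ≡ collapse (f t)) →
  ¬ (Image f (B ∣ H) ≐ U)
collapse-homogeneous B f H homogeneous (_ , onto) with onto {0} tt | onto {1} tt
... | s , s∈ , fs≡0 | t , t∈ , ft≡1
  with () ← trans (sym (cong collapse fs≡0)) (trans (homogeneous s t s∈ t∈) (cong collapse ft≡1))

proposition7 : ∀ (B : Barrier) → TS B ≤sW RT 2 B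
-- `query` returns the bit of the oracle at its input, which makes it the identity functional.
-- Neither program depends on `B`.
proposition7 B = proj₁ collapseCodeᶜ , query , λ I f codes →
  collapseCode I , (λ n → proj₂ collapseCodeᶜ I (n ∷ [])) ,
  collapse ∘ f , collapseCode-codes B I f codes ,
  λ H (infinite , H⊆base , homogeneous) →
    H , (λ n → query) , infinite , H⊆base , collapse-homogeneous B f H homogeneous
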